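{- Any indecomposable binary (rank $2$) $\mathbb Z$-lattice is not recoverable.
   Context: A $\mathbb Z$-lattice is a free $\mathbb Z$-module $L$ of finite rank with a positive definite symmetric bilinear form $B:L\times L\to\mathbb Z$ (integral valued). It is indecomposable if it is not the orthogonal direct sum of two nonzero sublattices. A $\mathbb Z$-lattice $\ell$ is represented by $L$ if there is a $\mathbb Z$-linear map $\sigma:\ell\to L$ with $B(\sigma x,\sigma y)=B(x,y)$ for all $x,y\in\ell$. A $\mathbb Z$-lattice $\ell$ is recoverable if there is a finite set $\{\ell_1,\dots,\ell_t\}$ of proper sublattices of $\ell$ such that every $\mathbb Z$-lattice (of any rank) that represents all of $\ell_1,\dots,\ell_t$ also represents $\ell$. -}

module Defs where

open import Algebra.Definitions.RawMonoid using (sum)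
open import Algebra.Module.Bundles using (LeftModule)
open import Algebra.Module.Bundles.Raw using (RawLeftModule)
open import Algebra.Module.Morphism.Structures
  using (IsLeftModuleHomomorphism; IsLeftModuleMonomorphism)
import Algebra.Module.Morphism.LeftModuleMonomorphism as LeftModuleMonomorphism
open import Data.Fin.Base using (Fin)
open import Data.Integer.Base using (ℤ; 0ℤ; _+_; _*_; _<_)
open import Data.Integer.Properties using (+-*-ring; +-*-isRing)
open import Data.List.Base using (List)
open import Data.List.Relation.Unary.All using (All)
open import Data.Nat.Base using (ℕ)
open import Data.Product.Base using (Σ; ∃-syntax; Σ-syntax; _×_; _,_; proj₁)
open import Function.Base using (id)
open import Level using (0ℓ)
open import Relation.Binary.Definitions using (_Respects_)
open import Relation.Binary.PropositionalEquality.Core using (_≡_)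
open import Relation.Nullary.Negation.Core using (¬_)
open import Relation.Unary using (Pred; _∈_)

-- A left module over the commutative ring ℤ is the same as a ℤ-module.  The
-- equality of a module is its setoid equality _≈ᴹ_.
ℤ-Module : Set₁
ℤ-Module = LeftModule +-*-ring 0ℓ 0ℓ

module _ (M : ℤ-Module) where
  open LeftModule M

  linComb : ∀ {n} → (Fin n → ℤ) → (Fin n → Carrierᴹ) → Carrierᴹ
  linComb c v = sum +ᴹ-rawMonoid (λ i → c i *ₗ v i)

  record FiniteBasis : Set where
    field
      rank        : ℕ
      vec         : Fin rank → Carrierᴹ
      spanning    : ∀ x → ∃[ c ] x ≈ᴹ linComb c vec
      independent : ∀ c → linComb c vec ≈ᴹ 0ᴹ → ∀ i → c i ≡ 0ℤ

  record Submodule : Set₁ where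
    field
      Member     : Pred Carrierᴹ 0ℓ
      resp       : Member Respects _≈ᴹ_
      0-closed   : 0ᴹ ∈ Member
      +-closed   : ∀ {x y} → x ∈ Member → y ∈ Member → x +ᴹ y ∈ Member
      neg-closed : ∀ {x} → x ∈ Member → -ᴹ x ∈ Member
      *-closed   : ∀ k {x} → x ∈ Member → k *ₗ x ∈ Member

-- Two elements of a submodule are equal when they are equal in the ambient
-- module, whatever their membership proofs.
submodule⇒module : {M : ℤ-Module} → Submodule M → ℤ-Module
submodule⇒module {M} S = record
  { RawLeftModule raw
  ; isLeftModule = LeftModuleMonomorphism.isLeftModule proj₁-mono +-*-isRing isLeftModule
  }
  where
  open LeftModule M
  open Submodule S

  raw : RawLeftModule ℤ 0ℓ 0ℓ
  raw = record
    { Carrierᴹ = Σ Carrierᴹ Member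
    ; _≈ᴹ_     = λ x y → proj₁ x ≈ᴹ proj₁ y
    ; _+ᴹ_     = λ (x , x∈) (y , y∈) → (x +ᴹ y) , +-closed x∈ y∈
    ; _*ₗ_     = λ k (x , x∈) → (k *ₗ x) , *-closed k x∈
    ; 0ᴹ       = 0ᴹ , 0-closed
    ; -ᴹ_      = λ (x , x∈) → (-ᴹ x) , neg-closed x∈
    }

  proj₁-mono : IsLeftModuleMonomorphism raw rawLeftModule proj₁
  proj₁-mono = record
    { isLeftModuleHomomorphism = record
      { +ᴹ-isGroupHomomorphism = record
        { isMonoidHomomorphism = record
          { isMagmaHomomorphism = record
            { isRelHomomorphism = record { cong = id }
            ; homo = λ _ _ → ≈ᴹ-refl
            }
          ; ε-homo = ≈ᴹ-refl
          }
        ; ⁻¹-homo = λ _ → ≈ᴹ-refl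
        }
      ; *ₗ-homo = λ _ _ → ≈ᴹ-refl
      }
    ; injective = id
    }

record ℤLattice : Set₁ where
  field
    module′ : ℤ-Module
    basis   : FiniteBasis module′

  open LeftModule module′ public
  open FiniteBasis basis public

  -- Linearity in the second argument follows from symmetry.
  field
    B        : Carrierᴹ → Carrierᴹ → ℤ
    B-cong   : ∀ {x x′ y y′} → x ≈ᴹ x′ → y ≈ᴹ y′ → B x y ≡ B x′ y′
    B-sym    : ∀ x y → B x y ≡ B y x
    B-+ˡ     : ∀ x y z → B (x +ᴹ y) z ≡ B x z + B y z
    B-*ˡ     : ∀ k x y → B (k *ₗ x) y ≡ k * B x y
    B-posDef : ∀ x → ¬ (x ≈ᴹ 0ᴹ) → 0ℤ < B x x

-- A submodule of a lattice that is itself free of finite rank.  (Classically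
-- every submodule is; constructively a basis has to be supplied.)
record Sublattice (L : ℤLattice) : Set₁ where
  field
    submodule : Submodule (ℤLattice.module′ L)
    subBasis  : FiniteBasis (submodule⇒module submodule)

  open Submodule submodule public

sublattice⇒lattice : {L : ℤLattice} → Sublattice L → ℤLattice
sublattice⇒lattice {L} M = record
  { module′  = submodule⇒module (Sublattice.submodule M)
  ; basis    = Sublattice.subBasis M
  ; B        = λ x y → B (proj₁ x) (proj₁ y)
  ; B-cong   = B-cong
  ; B-sym    = λ x y → B-sym (proj₁ x) (proj₁ y)
  ; B-+ˡ     = λ x y z → B-+ˡ (proj₁ x) (proj₁ y) (proj₁ z)
  ; B-*ˡ     = λ k x y → B-*ˡ k (proj₁ x) (proj₁ y)
  ; B-posDef = λ x → B-posDef (proj₁ x)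
  }
  where open ℤLattice L

module _ {L : ℤLattice} where
  open ℤLattice L

  Proper : Sublattice L → Set
  Proper M = ¬ (∀ x → x ∈ Sublattice.Member M)

  NonZero : Sublattice L → Set
  NonZero M = ∃[ x ] x ∈ Sublattice.Member M × ¬ (x ≈ᴹ 0ᴹ)

  record IsOrthogonalDirectSum (M N : Sublattice L) : Set where
    private
      module M = Sublattice M
      module N = Sublattice N
    field
      sums         : ∀ x → ∃[ m ] ∃[ n ] m ∈ M.Member × n ∈ N.Member × x ≈ᴹ m +ᴹ n
      intersection : ∀ x → x ∈ M.Member → x ∈ N.Member → x ≈ᴹ 0ᴹ
      orthogonal   : ∀ {m n} → m ∈ M.Member → n ∈ N.Member → B m n ≡ 0ℤ

Indecomposable : ℤLattice → Set₁
Indecomposable L =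
  ¬ (Σ[ M ∈ Sublattice L ] Σ[ N ∈ Sublattice L ]
       NonZero M × NonZero N × IsOrthogonalDirectSum M N)

record _Represents_ (L ℓ : ℤLattice) : Set where
  private
    module L = ℤLattice L
    module ℓ = ℤLattice ℓ
  field
    σ        : ℓ.Carrierᴹ → L.Carrierᴹ
    σ-linear : IsLeftModuleHomomorphism ℓ.rawLeftModule L.rawLeftModule σ
    σ-B      : ∀ x y → L.B (σ x) (σ y) ≡ ℓ.B x y

Recoverable : ℤLattice → Set₁
Recoverable ℓ =
  Σ[ S ∈ List (Sublattice ℓ) ]
    All Proper S ×
    (∀ (L : ℤLattice) → All (λ M → L Represents sublattice⇒lattice M) S → L Represents ℓ)

-- The orthogonal sum of finitely many proper sublattices M₁, …, Mₜ of ℓ represents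
-- every Mᵢ but not ℓ.  Let v, w be a Gauss-reduced basis of ℓ; indecomposability
-- means B v w ≠ 0.  Suppose σ embeds ℓ into the sum.  Every component of σ v lies in ℓ,
-- so its norm is 0 or at least the minimum Q v; hence σ v lies in a single summand Mᵢ.
-- Let y be the component of σ w in Mᵢ, so that B (σ v) y = B v w and Q y ≤ Q w.  The
-- Gram determinant of σ v, y is then at most that of v, w, and it is nonzero because
-- y is not a multiple of σ v (0 < 2 |B v w| ≤ Q v).  Thus σ v, y is a basis of ℓ, and
-- Mᵢ = ℓ is not proper.
module Submission where

open import Defs
open import Relation.Binary.PropositionalEquality using (_≡_)
open import Relation.Nullary using (¬_)

open import Algebra.Bundles using (CommutativeMonoid; Monoid)
open import Algebra.Definitions.RawMonoid using () renaming (sum to rawSum)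
open import Algebra.Module.Bundles using (LeftModule)
import Algebra.Module.Construct.DirectProduct as DirectProduct
import Algebra.Module.Construct.Zero as Zero
open import Algebra.Module.Morphism.Construct.Composition using (isLeftModuleHomomorphism)
import Algebra.Module.Properties.LeftModule as LeftModuleProperties
import Algebra.Properties.CommutativeSemigroup as CommutativeSemigroupProperties
import Algebra.Properties.Monoid.Sum as Sum
open import Data.Empty using (⊥)
open import Data.Fin.Base using (Fin; zero; suc; _↑ˡ_; _↑ʳ_; splitAt)
open import Data.Fin.Properties using (join-splitAt)
open import Data.Integer.Base hiding (suc; NonZero)
open import Data.Integer.Properties
open import Data.Integer.Tactic.RingSolver using (solve-∀)
open import Data.List.Base using (List; []; _∷_)
open import Data.List.Relation.Unary.All as All using (All; []; _∷_)
open import Data.Nat.Base as ℕ using (ℕ; zero; suc)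
open import Data.Product.Base using (∃-syntax; _×_; _,_; proj₁; proj₂)
open import Data.Sum.Base using (_⊎_; inj₁; inj₂)
open import Data.Vec.Functional using (Vector; _++_)
open import Data.Vec.Functional.Properties using (lookup-++ˡ; lookup-++ʳ)
open import Function.Base using (_∘_)
open import Level using (0ℓ)
open import Relation.Binary.Definitions using (tri<; tri≈; tri>)
open import Relation.Binary.PropositionalEquality
  using (_≢_; refl; sym; trans; cong; cong₂; subst; subst₂; module ≡-Reasoning)
import Relation.Binary.Reasoning.Setoid as SetoidReasoning
open import Relation.Nullary using (yes; no; contradiction; decidable-stable)

-- Signs of integer products and squares.

0≤i*j : ∀ {i j} → 0ℤ ≤ i → 0ℤ ≤ j → 0ℤ ≤ i * j
0≤i*j {i} {j} 0≤i 0≤j =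
  subst (_≤ i * j) (*-zeroʳ i) (*-monoˡ-≤-nonNeg i {{nonNegative 0≤i}} 0≤j)

0<i*j : ∀ {i j} → 0ℤ < i → 0ℤ < j → 0ℤ < i * j
0<i*j {i} {j} 0<i 0<j =
  subst (_< i * j) (*-zeroʳ i) (*-monoˡ-<-pos i {{positive 0<i}} 0<j)

0≤i² : ∀ i → 0ℤ ≤ i * i
0≤i² i with ≤-total 0ℤ i
... | inj₁ 0≤i = 0≤i*j 0≤i 0≤i
... | inj₂ i≤0 = subst (0ℤ ≤_) (lemma i) (0≤i*j (neg-mono-≤ i≤0) (neg-mono-≤ i≤0))
  where
  lemma : ∀ i → - i * - i ≡ i * i
  lemma = solve-∀

i²≡0⇒i≡0 : ∀ i → i * i ≡ 0ℤ → i ≡ 0ℤ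
i²≡0⇒i≡0 i i²≡0 with i*j≡0⇒i≡0∨j≡0 i i²≡0
... | inj₁ i≡0 = i≡0
... | inj₂ i≡0 = i≡0

-- Discreteness of ℤ, put as a nonnegative difference so that it can enter the polynomial identities
-- below as a factor.
0<i⇒0≤i-1 : ∀ {i} → 0ℤ < i → 0ℤ ≤ i - 1ℤ
0<i⇒0≤i-1 0<i = i≤j⇒0≤j-i (i<j⇒suc[i]≤j 0<i)

i≢0⇒0≤i²-1 : ∀ {i} → i ≢ 0ℤ → 0ℤ ≤ i * i - 1ℤ
i≢0⇒0≤i²-1 {i} i≢0 =
  0<i⇒0≤i-1 (≤∧≢⇒< (0≤i² i) (λ 0≡i² → i≢0 (i²≡0⇒i≡0 i (sym 0≡i²))))

i<j⇒0<j-i : ∀ {i j} → i < j → 0ℤ < j - i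
i<j⇒0<j-i {i} {j} i<j = subst (_< j - i) (+-inverseʳ i) (+-monoˡ-< (- i) i<j)

nonNegative-sum-zero : ∀ {i j} → 0ℤ ≤ i → 0ℤ ≤ j → i + j ≡ 0ℤ → i ≡ 0ℤ × j ≡ 0ℤ
nonNegative-sum-zero {i} {j} 0≤i 0≤j i+j≡0 =
  ≤-antisym (subst (i ≤_) i+j≡0 (i≤i+j i j {{nonNegative 0≤j}})) 0≤i ,
  ≤-antisym (subst (j ≤_) i+j≡0 (i≤j+i j i {{nonNegative 0≤i}})) 0≤j

-- Binary quadratic forms

-- The coefficient of b is left as `m * n + n * m` so that the value agrees literally with `B-comb`
-- at two equal coefficient pairs.
form : ℤ → ℤ → ℤ → ℤ → ℤ → ℤ
form a b c m n = m * m * a + (m * n + n * m) * b + n * n * c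

-- Gauss reduction, 2|b| ≤ a ≤ c with a > 0, for the Gram matrix with diagonal a, c and off-diagonal
-- entry b. The last three conditions are nonnegative differences, ready to be multiplied.
record IsReduced (a b c : ℤ) : Set where
  field
    a>0    : 0ℤ < a
    a≤c    : 0ℤ ≤ c - a
    2b≤a   : 0ℤ ≤ a - + 2 * b
    -a≤2b  : 0ℤ ≤ a + + 2 * b

module _ {a b c : ℤ} (reduced : IsReduced a b c) where
  open IsReduced reduced

  private
    a≥0 : 0ℤ ≤ a
    a≥0 = <⇒≤ a>0

    c≥0 : 0ℤ ≤ c
    c≥0 = ≤-trans a≥0 (0≤i-j⇒j≤i a≤c)

  -- In each case the value minus a is written as a sum of products of nonnegative factors. If
  -- neither coefficient vanishes, the sign of m n decides between completing with (m - n)² and a +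
  -- 2b, or with (m + n)² and a - 2b.
  reduced-minimum : ∀ m n → form a b c m n ≢ 0ℤ → a ≤ form a b c m n
  reduced-minimum m n form≢0 with m ≟ 0ℤ | n ≟ 0ℤ
  ... | yes refl | yes refl = contradiction (lemma a b c) form≢0
    where
    lemma : ∀ a b c → 0ℤ * 0ℤ * a + (0ℤ * 0ℤ + 0ℤ * 0ℤ) * b + 0ℤ * 0ℤ * c ≡ 0ℤ
    lemma = solve-∀
  ... | yes refl | no n≢0 = 0≤i-j⇒j≤i (subst (0ℤ ≤_) (lemma a b c n)
          (+-mono-≤ (0≤i*j c≥0 (i≢0⇒0≤i²-1 n≢0)) a≤c))
    where
    lemma : ∀ a b c n → c * (n * n - 1ℤ) + (c - a) 
                        ≡ 0ℤ * 0ℤ * a + (0ℤ * n + n * 0ℤ) * b + n * n * c - a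
    lemma = solve-∀
  ... | no m≢0 | yes refl = 0≤i-j⇒j≤i (subst (0ℤ ≤_) (lemma a b c m)
          (0≤i*j a≥0 (i≢0⇒0≤i²-1 m≢0)))
    where
    lemma : ∀ a b c m → a * (m * m - 1ℤ) 
                      ≡ m * m * a + (m * 0ℤ + 0ℤ * m) * b + 0ℤ * 0ℤ * c - a
    lemma = solve-∀
  ... | no m≢0 | no n≢0 with <-cmp 0ℤ (m * n)
  ...   | tri< 0<mn _ _ = 0≤i-j⇒j≤i (subst (0ℤ ≤_) (lemma a b c m n)
            (+-mono-≤ (+-mono-≤
              (0≤i*j a≥0 (+-mono-≤ (0≤i² (m - n)) (0<i⇒0≤i-1 0<mn)))
              (0≤i*j -a≤2b (<⇒≤ 0<mn)))
              (0≤i*j a≤c (0≤i² n))))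
    where
    lemma : ∀ a b c m n →
      a * ((m - n) * (m - n) + (m * n - 1ℤ)) + (a + + 2 * b) * (m * n)
        + (c - a) * (n * n) ≡ m * m * a + (m * n + n * m) * b + n * n * c - a
    lemma = solve-∀
  ...   | tri≈ _ 0≡mn _ with i*j≡0⇒i≡0∨j≡0 m (sym 0≡mn)
  ...     | inj₁ m≡0 = contradiction m≡0 m≢0
  ...     | inj₂ n≡0 = contradiction n≡0 n≢0
  reduced-minimum m n form≢0 | no m≢0 | no n≢0
        | tri> _ _ mn<0 = 0≤i-j⇒j≤i (subst (0ℤ ≤_) (lemma a b c m n)
            (+-mono-≤ (+-mono-≤
              (0≤i*j a≥0 (+-mono-≤ (0≤i² (m + n)) (0<i⇒0≤i-1 0<-mn)))
              (0≤i*j 2b≤a (<⇒≤ 0<-mn)))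
              (0≤i*j a≤c (0≤i² n))))
    where
    0<-mn : 0ℤ < - (m * n)
    0<-mn = neg-mono-< mn<0
    lemma : ∀ a b c m n →
      a * ((m + n) * (m + n) + (- (m * n) - 1ℤ)) + (a - + 2 * b) * (- (m * n))
        + (c - a) * (n * n) ≡ m * m * a + (m * n + n * m) * b + n * n * c - a
    lemma = solve-∀

  -- Here d is the determinant of the coordinates of two vectors with Gram entries a, b, e. If d ≠
  -- 0, then e ≤ c gives d² Δ ≤ Δ for Δ = a c - b², and Δ cancels. If d = 0, then a e = b², which
  -- the two possibilities for e exclude.
  reduced-unimodular : ∀ {d e} → b ≢ 0ℤ → 0ℤ < a * c - b * b → e ≡ 0ℤ ⊎ a ≤ e → e ≤ c →
                       d * d * (a * c - b * b) ≡ a * e - b * b → d * d ≡ 1ℤ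
  reduced-unimodular {d} {e} b≢0 Δ>0 e-value e≤c det with d ≟ 0ℤ
  ... | no d≢0 = ≤-antisym d²≤1 (0≤i-j⇒j≤i (i≢0⇒0≤i²-1 d≢0))
    where
    d²≤1 : d * d ≤ 1ℤ
    d²≤1 = *-cancelʳ-≤-pos (d * d) 1ℤ (a * c - b * b) {{positive Δ>0}}
      (0≤i-j⇒j≤i (subst (0ℤ ≤_)
        (trans (lemma a b c e) (cong (λ z → 1ℤ * (a * c - b * b) - z) (sym det)))
        (0≤i*j a≥0 (i≤j⇒0≤j-i e≤c))))
      where
      lemma : ∀ a b c e → a * (c - e) ≡ 1ℤ * (a * c - b * b) - (a * e - b * b)
      lemma = solve-∀
  ... | yes refl with e-value
  ...   | inj₁ refl = contradiction (i²≡0⇒i≡0 b b²≡0) b≢0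
    where
    lemma : ∀ a b c → b * b ≡ 0ℤ * 0ℤ * (a * c - b * b) - (a * 0ℤ - b * b)
    lemma = solve-∀
    b²≡0 : b * b ≡ 0ℤ
    b²≡0 = trans (lemma a b c) (i≡j⇒i-j≡0 det)
  -- Here a e = b², but 4 b² ≤ a² ≤ a e: the summands are 3 a², a² − 4 b² and 4 (a e − a²).
  ...   | inj₂ a≤e = contradiction
            (+-mono-<-≤ (0<i*j {+ 3} (+<+ (ℕ.s≤s ℕ.z≤n)) (0<i*j a>0 a>0))
              (+-mono-≤ (0≤i*j 2b≤a -a≤2b) (0≤i*j {+ 4} (+≤+ ℕ.z≤n) (0≤i*j a≥0 (i≤j⇒0≤j-i a≤e)))))
            (<-irrefl (sym (trans (lemma a b c e) (cong (+ 4 *_) (i≡j⇒i-j≡0 (sym det))))))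
    where
    lemma : ∀ a b c e → + 3 * (a * a) + ((a - + 2 * b) * (a + + 2 * b) + + 4 * (a * (e - a)))
                      ≡ + 4 * (a * e - b * b - 0ℤ * 0ℤ * (a * c - b * b))
    lemma = solve-∀

-- Orthogonal sums

module _ (M : Monoid 0ℓ 0ℓ) where
  open Monoid M renaming (refl to ≈-refl; sym to ≈-sym; trans to ≈-trans)
  open Sum M using (sum; sum-cong-≋; sum-replicate-zero)

  sum-split : ∀ m {n} (f : Vector Carrier (m ℕ.+ n)) →
              sum f ≈ sum (f ∘ (_↑ˡ n)) ∙ sum (f ∘ (m ↑ʳ_))
  sum-split zero    f = ≈-sym (identityˡ _)
  sum-split (suc m) f = ≈-trans (∙-congˡ (sum-split m (f ∘ suc))) (≈-sym (assoc _ _ _))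

  sum-zero : ∀ {n} (f : Vector Carrier n) → (∀ i → f i ≈ ε) → sum f ≈ ε
  sum-zero {n} f f≈0 = ≈-trans (sum-cong-≋ f≈0) (sum-replicate-zero n)

linComb-cong : ∀ (M : ℤ-Module) {n} {c d : Fin n → ℤ} (u : Vector (LeftModule.Carrierᴹ M) n) →
               (∀ i → c i ≡ d i) → LeftModule._≈ᴹ_ M (linComb M c u) (linComb M d u)
linComb-cong M u c≗d = Sum.sum-cong-≋ (LeftModule.+ᴹ-monoid M) λ i → LeftModule.*ₗ-congʳ M (c≗d i)

module _ (M N : ℤ-Module) where
  private
    module M = LeftModule M
    module N = LeftModule N

  infixr 6 _⊕_
  _⊕_ : ℤ-Module
  _⊕_ = DirectProduct.leftModule M N

  private
    module M⊕N = LeftModule _⊕_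

  proj₁-sum : ∀ {n} (f : Vector M⊕N.Carrierᴹ n) →
              proj₁ (rawSum M⊕N.+ᴹ-rawMonoid f) ≡ rawSum M.+ᴹ-rawMonoid (proj₁ ∘ f)
  proj₁-sum {zero}  f = refl
  proj₁-sum {suc n} f = cong (proj₁ (f zero) M.+ᴹ_) (proj₁-sum (f ∘ suc))

  proj₂-sum : ∀ {n} (f : Vector M⊕N.Carrierᴹ n) →
              proj₂ (rawSum M⊕N.+ᴹ-rawMonoid f) ≡ rawSum N.+ᴹ-rawMonoid (proj₂ ∘ f)
  proj₂-sum {zero}  f = refl
  proj₂-sum {suc n} f = cong (proj₂ (f zero) N.+ᴹ_) (proj₂-sum (f ∘ suc))

  module _ {m n} (u : Vector M.Carrierᴹ m) (v : Vector N.Carrierᴹ n) where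

    ⊕-vec : Vector M⊕N.Carrierᴹ (m ℕ.+ n)
    ⊕-vec = (λ i → u i , N.0ᴹ) ++ (λ j → M.0ᴹ , v j)

    private
      ⊕-vecˡ : ∀ i → ⊕-vec (i ↑ˡ n) ≡ (u i , N.0ᴹ)
      ⊕-vecˡ = lookup-++ˡ _ _

      ⊕-vecʳ : ∀ j → ⊕-vec (m ↑ʳ j) ≡ (M.0ᴹ , v j)
      ⊕-vecʳ = lookup-++ʳ (λ i → u i , N.0ᴹ) _

    proj₁-linComb : ∀ c → proj₁ (linComb _⊕_ c ⊕-vec) M.≈ᴹ linComb M (c ∘ (_↑ˡ n)) u
    proj₁-linComb c = begin
      proj₁ (linComb _⊕_ c ⊕-vec)
        ≡⟨ proj₁-sum (λ i → c i M⊕N.*ₗ ⊕-vec i) ⟩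
      rawSum M.+ᴹ-rawMonoid (λ i → c i M.*ₗ proj₁ (⊕-vec i))
        ≈⟨ sum-split M.+ᴹ-monoid m _ ⟩
      rawSum M.+ᴹ-rawMonoid (λ i → c (i ↑ˡ n) M.*ₗ proj₁ (⊕-vec (i ↑ˡ n)))
        M.+ᴹ rawSum M.+ᴹ-rawMonoid (λ j → c (m ↑ʳ j) M.*ₗ proj₁ (⊕-vec (m ↑ʳ j)))
        ≈⟨ M.+ᴹ-cong
             (Sum.sum-cong-≋ M.+ᴹ-monoid λ i →
               M.≈ᴹ-reflexive (cong (λ z → c (i ↑ˡ n) M.*ₗ proj₁ z) (⊕-vecˡ i)))
             (sum-zero M.+ᴹ-monoid _ λ j → M.≈ᴹ-trans
               (M.≈ᴹ-reflexive (cong (λ z → c (m ↑ʳ j) M.*ₗ proj₁ z) (⊕-vecʳ j)))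
               (M.*ₗ-zeroʳ _)) ⟩
      linComb M (c ∘ (_↑ˡ n)) u M.+ᴹ M.0ᴹ
        ≈⟨ M.+ᴹ-identityʳ _ ⟩
      linComb M (c ∘ (_↑ˡ n)) u ∎
      where open SetoidReasoning M.≈ᴹ-setoid

    proj₂-linComb : ∀ c → proj₂ (linComb _⊕_ c ⊕-vec) N.≈ᴹ linComb N (c ∘ (m ↑ʳ_)) v
    proj₂-linComb c = begin
      proj₂ (linComb _⊕_ c ⊕-vec)
        ≡⟨ proj₂-sum (λ i → c i M⊕N.*ₗ ⊕-vec i) ⟩
      rawSum N.+ᴹ-rawMonoid (λ i → c i N.*ₗ proj₂ (⊕-vec i))
        ≈⟨ sum-split N.+ᴹ-monoid m _ ⟩
      rawSum N.+ᴹ-rawMonoid (λ i → c (i ↑ˡ n) N.*ₗ proj₂ (⊕-vec (i ↑ˡ n)))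
        N.+ᴹ rawSum N.+ᴹ-rawMonoid (λ j → c (m ↑ʳ j) N.*ₗ proj₂ (⊕-vec (m ↑ʳ j)))
        ≈⟨ N.+ᴹ-cong
             (sum-zero N.+ᴹ-monoid _ λ i → N.≈ᴹ-trans
               (N.≈ᴹ-reflexive (cong (λ z → c (i ↑ˡ n) N.*ₗ proj₂ z) (⊕-vecˡ i)))
               (N.*ₗ-zeroʳ _))
             (Sum.sum-cong-≋ N.+ᴹ-monoid λ j →
               N.≈ᴹ-reflexive (cong (λ z → c (m ↑ʳ j) N.*ₗ proj₂ z) (⊕-vecʳ j))) ⟩
      N.0ᴹ N.+ᴹ linComb N (c ∘ (m ↑ʳ_)) v
        ≈⟨ N.+ᴹ-identityˡ _ ⟩
      linComb N (c ∘ (m ↑ʳ_)) v ∎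
      where open SetoidReasoning N.≈ᴹ-setoid

  ⊕-basis : FiniteBasis M → FiniteBasis N → FiniteBasis _⊕_
  ⊕-basis bM bN = record
    { rank        = bM.rank ℕ.+ bN.rank
    ; vec         = vec
    ; spanning    = spanning
    ; independent = independent
    }
    where
    module bM = FiniteBasis bM
    module bN = FiniteBasis bN

    vec : Vector M⊕N.Carrierᴹ (bM.rank ℕ.+ bN.rank)
    vec = ⊕-vec bM.vec bN.vec

    spanning : ∀ x → ∃[ c ] x M⊕N.≈ᴹ linComb _⊕_ c vec
    spanning (x , y) with bM.spanning x | bN.spanning y
    ... | c , x≈ | d , y≈ = c ++ d ,
      M.≈ᴹ-trans x≈ (M.≈ᴹ-sym (M.≈ᴹ-trans (proj₁-linComb bM.vec bN.vec (c ++ d))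
        (linComb-cong M bM.vec (lookup-++ˡ c d)))) ,
      N.≈ᴹ-trans y≈ (N.≈ᴹ-sym (N.≈ᴹ-trans (proj₂-linComb bM.vec bN.vec (c ++ d))
        (linComb-cong N bN.vec (lookup-++ʳ c d))))

    independent : ∀ c → linComb _⊕_ c vec M⊕N.≈ᴹ M⊕N.0ᴹ → ∀ i → c i ≡ 0ℤ
    independent c (≈₁ , ≈₂) i
      -- Matching the second equation with `refl` turns i into an injected index of one factor.
      with splitAt bM.rank i | join-splitAt bM.rank bN.rank i
    ... | inj₁ j | refl = bM.independent (c ∘ (_↑ˡ bN.rank))
      (M.≈ᴹ-trans (M.≈ᴹ-sym (proj₁-linComb bM.vec bN.vec c)) ≈₁) j
    ... | inj₂ j | refl = bN.independent (c ∘ (bM.rank ↑ʳ_))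
      (N.≈ᴹ-trans (N.≈ᴹ-sym (proj₂-linComb bM.vec bN.vec c)) ≈₂) j

-- Bilinearity and vectors of norm zero.

module Lattice (L : ℤLattice) where
  open ℤLattice L public

  B-+ʳ : ∀ x y z → B x (y +ᴹ z) ≡ B x y + B x z
  B-+ʳ x y z = trans (B-sym _ _) (trans (B-+ˡ y z x) (cong₂ _+_ (B-sym y x) (B-sym z x)))

  B-*ʳ : ∀ k x y → B x (k *ₗ y) ≡ k * B x y
  B-*ʳ k x y = trans (B-sym _ _) (trans (B-*ˡ k y x) (cong (k *_) (B-sym y x)))

  B-0ˡ : ∀ y → B 0ᴹ y ≡ 0ℤ
  B-0ˡ y = trans (B-cong (≈ᴹ-sym (*ₗ-zeroˡ 0ᴹ)) ≈ᴹ-refl) (trans (B-*ˡ 0ℤ 0ᴹ y) (*-zeroˡ (B 0ᴹ y)))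

  ≈0⇒B≡0 : ∀ {x} → x ≈ᴹ 0ᴹ → ∀ y → B x y ≡ 0ℤ
  ≈0⇒B≡0 x≈0 y = trans (B-cong x≈0 ≈ᴹ-refl) (B-0ˡ y)

  Q : Carrierᴹ → ℤ
  Q x = B x x

  -- `B-posDef` asks for a proof that x is nonzero. A double negation on the decidable inequality
  -- avoids deciding `x ≈ᴹ 0ᴹ`.
  Q-nonNegative : ∀ x → 0ℤ ≤ Q x
  Q-nonNegative x = decidable-stable (0ℤ ≤? Q x) λ Q≱0 →
    Q≱0 (<⇒≤ (B-posDef x λ x≈0 → Q≱0 (≤-reflexive (sym (≈0⇒B≡0 x≈0 x)))))

  -- The double negation is harmless: it is only opened towards `⊥` or a decidable equation in ℤ.
  Q≡0⇒¬¬≈0 : ∀ {x} → Q x ≡ 0ℤ → ¬ ¬ (x ≈ᴹ 0ᴹ)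
  Q≡0⇒¬¬≈0 Q≡0 x≉0 = <-irrefl (sym Q≡0) (B-posDef _ x≉0)

  Q≡0⇒B≡0 : ∀ {x} → Q x ≡ 0ℤ → ∀ y → B x y ≡ 0ℤ
  Q≡0⇒B≡0 {x} Q≡0 y = decidable-stable (B x y ≟ 0ℤ) λ B≢0 →
    Q≡0⇒¬¬≈0 Q≡0 λ x≈0 → B≢0 (≈0⇒B≡0 x≈0 y)

infixr 6 _⟂_
_⟂_ : ℤLattice → ℤLattice → ℤLattice
L ⟂ N = record
  { module′  = L.module′ ⊕ N.module′
  ; basis    = ⊕-basis L.module′ N.module′ L.basis N.basis
  ; B        = B
  ; B-cong   = λ (p , q) (p′ , q′) → cong₂ _+_ (L.B-cong p p′) (N.B-cong q q′)
  ; B-sym    = λ (x , y) (x′ , y′) → cong₂ _+_ (L.B-sym x x′) (N.B-sym y y′)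
  ; B-+ˡ     = λ (x , y) (x′ , y′) (x″ , y″) →
      trans (cong₂ _+_ (L.B-+ˡ x x′ x″) (N.B-+ˡ y y′ y″))
            (+-interchange (L.B x x″) (L.B x′ x″) (N.B y y″) (N.B y′ y″))
  ; B-*ˡ     = λ k (x , y) (x′ , y′) →
      trans (cong₂ _+_ (L.B-*ˡ k x x′) (N.B-*ˡ k y y′))
            (sym (*-distribˡ-+ k (L.B x x′) (N.B y y′)))
  ; B-posDef = B-posDef
  }
  where
  module L = Lattice L
  module N = Lattice N

  B : L.Carrierᴹ × N.Carrierᴹ → L.Carrierᴹ × N.Carrierᴹ → ℤ
  B (x , y) (x′ , y′) = L.B x x′ + N.B y y′

  +-interchange : ∀ i j k l → (i + j) + (k + l) ≡ (i + k) + (j + l)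
  +-interchange = solve-∀

  B-posDef : ∀ x → ¬ (proj₁ x L.≈ᴹ L.0ᴹ × proj₂ x N.≈ᴹ N.0ᴹ) → 0ℤ < B x x
  B-posDef (x , y) ≉0 = ≤∧≢⇒< (+-mono-≤ (L.Q-nonNegative x) (N.Q-nonNegative y)) λ 0≡ →
    let (Qx≡0 , Qy≡0) = nonNegative-sum-zero (L.Q-nonNegative x) (N.Q-nonNegative y) (sym 0≡)
    in L.Q≡0⇒¬¬≈0 Qx≡0 λ x≈0 → N.Q≡0⇒¬¬≈0 Qy≡0 λ y≈0 → ≉0 (x≈0 , y≈0)

-- The family of sublattices may be empty, so its orthogonal sum must start from rank 0.
zeroLattice : ℤLattice
zeroLattice = record
  { module′  = Zero.leftModule
  ; basis    = record
    { rank = 0 ; vec = λ () ; spanning = λ _ → (λ ()) , _ ; independent = λ _ _ () }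
  ; B        = λ _ _ → 0ℤ
  ; B-cong   = λ _ _ → refl
  ; B-sym    = λ _ _ → refl
  ; B-+ˡ     = λ _ _ _ → refl
  ; B-*ˡ     = λ k _ _ → sym (*-zeroʳ k)
  ; B-posDef = λ _ ≉0 → contradiction _ ≉0
  }

represents-trans : ∀ {L M N} → L Represents M → M Represents N → L Represents N
represents-trans {L} f g = record
  { σ        = f.σ ∘ g.σ
  ; σ-linear = isLeftModuleHomomorphism (ℤLattice.≈ᴹ-trans L) g.σ-linear f.σ-linear
  ; σ-B      = λ x y → trans (f.σ-B _ _) (g.σ-B x y)
  }
  where
  module f = _Represents_ f
  module g = _Represents_ g

⟂-representsˡ : ∀ L N → (L ⟂ N) Represents L
⟂-representsˡ L N = record
  { σ        = λ x → x , N.0ᴹ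
  ; σ-linear = record
    { +ᴹ-isGroupHomomorphism = record
      { isMonoidHomomorphism = record
        { isMagmaHomomorphism = record
          { isRelHomomorphism = record { cong = λ x≈y → x≈y , N.≈ᴹ-refl }
          ; homo = λ _ _ → L.≈ᴹ-refl , N.≈ᴹ-sym (N.+ᴹ-identityˡ N.0ᴹ)
          }
        ; ε-homo = L.≈ᴹ-refl , N.≈ᴹ-refl
        }
      ; ⁻¹-homo = λ _ → L.≈ᴹ-refl ,
          N.≈ᴹ-trans (N.≈ᴹ-sym (N.-ᴹ‿inverseʳ N.0ᴹ)) (N.+ᴹ-identityˡ _)
      }
    ; *ₗ-homo = λ k _ → L.≈ᴹ-refl , N.≈ᴹ-sym (N.*ₗ-zeroʳ k)
    }
  ; σ-B      = λ x y → trans (cong (λ z → L.B x y + z) (N.B-0ˡ N.0ᴹ)) (+-identityʳ _)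
  }
  where
  module L = Lattice L
  module N = Lattice N

⟂-representsʳ : ∀ L N → (L ⟂ N) Represents N
⟂-representsʳ L N = record
  { σ        = λ y → L.0ᴹ , y
  ; σ-linear = record
    { +ᴹ-isGroupHomomorphism = record
      { isMonoidHomomorphism = record
        { isMagmaHomomorphism = record
          { isRelHomomorphism = record { cong = λ x≈y → L.≈ᴹ-refl , x≈y }
          ; homo = λ _ _ → L.≈ᴹ-sym (L.+ᴹ-identityˡ L.0ᴹ) , N.≈ᴹ-refl
          }
        ; ε-homo = L.≈ᴹ-refl , N.≈ᴹ-refl
        }
      ; ⁻¹-homo = λ _ →
          L.≈ᴹ-trans (L.≈ᴹ-sym (L.-ᴹ‿inverseʳ L.0ᴹ)) (L.+ᴹ-identityˡ _) , N.≈ᴹ-refl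
      }
    ; *ₗ-homo = λ k _ → L.≈ᴹ-sym (L.*ₗ-zeroʳ k) , N.≈ᴹ-refl
    }
  ; σ-B      = λ x y → trans (cong (λ z → z + N.B x y) (L.B-0ˡ L.0ᴹ)) (+-identityˡ _)
  }
  where
  module L = Lattice L
  module N = Lattice N

⨁ : {ℓ : ℤLattice} → List (Sublattice ℓ) → ℤLattice
⨁ []      = zeroLattice
⨁ (M ∷ S) = sublattice⇒lattice M ⟂ ⨁ S

⨁-represents : {ℓ : ℤLattice} (S : List (Sublattice ℓ)) →
               All (λ M → ⨁ S Represents sublattice⇒lattice M) S
⨁-represents []      = []
⨁-represents (M ∷ S) =
  ⟂-representsˡ (sublattice⇒lattice M) (⨁ S) ∷
  All.map (represents-trans (⟂-representsʳ (sublattice⇒lattice M) (⨁ S))) (⨁-represents S)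

-- Gauss reduction

module Binary (ℓ : ℤLattice) where
  open Lattice ℓ

  comb : ℤ → ℤ → Carrierᴹ → Carrierᴹ → Carrierᴹ
  comb m n v w = m *ₗ v +ᴹ n *ₗ w

  B-combˡ : ∀ m n v w x → B (comb m n v w) x ≡ m * B v x + n * B w x
  B-combˡ m n v w x = trans (B-+ˡ _ _ x) (cong₂ _+_ (B-*ˡ m v x) (B-*ˡ n w x))

  B-combʳ : ∀ m n v w x → B x (comb m n v w) ≡ m * B x v + n * B x w
  B-combʳ m n v w x = trans (B-+ʳ x _ _) (cong₂ _+_ (B-*ʳ m x v) (B-*ʳ n x w))

  B-comb : ∀ m n p q v w → B (comb m n v w) (comb p q v w)
                         ≡ m * p * B v v + (m * q + n * p) * B v w + n * q * B w w
  B-comb m n p q v w = begin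
    B (comb m n v w) (comb p q v w)
      ≡⟨ B-combˡ m n v w _ ⟩
    m * B v (comb p q v w) + n * B w (comb p q v w)
      ≡⟨ cong₂ (λ i j → m * i + n * j) (B-combʳ p q v w v) (B-combʳ p q v w w) ⟩
    m * (p * B v v + q * B v w) + n * (p * B w v + q * B w w)
      ≡⟨ cong (λ i → m * (p * B v v + q * B v w) + n * (p * i + q * B w w)) (B-sym w v) ⟩
    m * (p * B v v + q * B v w) + n * (p * B v w + q * B w w)
      ≡⟨ lemma m n p q (B v v) (B v w) (B w w) ⟩
    m * p * B v v + (m * q + n * p) * B v w + n * q * B w w ∎
    where
    open ≡-Reasoning
    lemma : ∀ m n p q a b c → m * (p * a + q * b) + n * (p * b + q * c)
                            ≡ m * p * a + (m * q + n * p) * b + n * q * c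
    lemma = solve-∀

  comb-cong : ∀ {m m′ n n′ v w} → m ≡ m′ → n ≡ n′ → comb m n v w ≈ᴹ comb m′ n′ v w
  comb-cong refl refl = ≈ᴹ-refl

  comb-comb : ∀ r s m n p q v w → comb r s (comb m n v w) (comb p q v w)
                                ≈ᴹ comb (r * m + s * p) (r * n + s * q) v w
  comb-comb r s m n p q v w = begin
    r *ₗ (m *ₗ v +ᴹ n *ₗ w) +ᴹ s *ₗ (p *ₗ v +ᴹ q *ₗ w)
      ≈⟨ +ᴹ-cong (distribute r m n) (distribute s p q) ⟩
    ((r * m) *ₗ v +ᴹ (r * n) *ₗ w) +ᴹ ((s * p) *ₗ v +ᴹ (s * q) *ₗ w)
      ≈⟨ interchange _ _ _ _ ⟩
    ((r * m) *ₗ v +ᴹ (s * p) *ₗ v) +ᴹ ((r * n) *ₗ w +ᴹ (s * q) *ₗ w)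
      ≈⟨ +ᴹ-cong (*ₗ-distribʳ v _ _) (*ₗ-distribʳ w _ _) ⟨
    comb (r * m + s * p) (r * n + s * q) v w ∎
    where
    open SetoidReasoning ≈ᴹ-setoid
    open CommutativeSemigroupProperties
      (CommutativeMonoid.commutativeSemigroup +ᴹ-commutativeMonoid) using (interchange)
    distribute : ∀ k i j → k *ₗ (i *ₗ v +ᴹ j *ₗ w) ≈ᴹ (k * i) *ₗ v +ᴹ (k * j) *ₗ w
    distribute k i j = ≈ᴹ-trans (*ₗ-distribˡ k _ _)
      (+ᴹ-cong (≈ᴹ-sym (*ₗ-assoc k i v)) (≈ᴹ-sym (*ₗ-assoc k j w)))

  Spans : Carrierᴹ → Carrierᴹ → Set
  Spans v w = ∀ x → ∃[ m ] ∃[ n ] x ≈ᴹ comb m n v w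

  spans-cong : ∀ {v v′ w w′} → v ≈ᴹ v′ → w ≈ᴹ w′ → Spans v w → Spans v′ w′
  spans-cong v≈ w≈ spans x with spans x
  ... | m , n , x≈ = m , n , ≈ᴹ-trans x≈ (+ᴹ-cong (*ₗ-congˡ v≈) (*ₗ-congˡ w≈))

  spans-unimodular : ∀ {v w} → Spans v w → ∀ m n p q → (m * q - n * p) * (m * q - n * p) ≡ 1ℤ →
                     Spans (comb m n v w) (comb p q v w)
  spans-unimodular {v} {w} spans m n p q ε²≡1 x with spans x
  ... | i , j , x≈ = r , s , ≈ᴹ-trans x≈ (≈ᴹ-sym (≈ᴹ-trans (comb-comb r s m n p q v w)
    (comb-cong (trans (lemma₁ i j m n p q) (cancel i)) (trans (lemma₂ i j m n p q) (cancel j)))))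
    where
    ε r s : ℤ
    ε = m * q - n * p
    -- Cramer's rule for the coordinates in the new pair. Since ε² = 1, dividing by ε is multiplying
    -- by it.
    r = ε * (i * q - j * p)
    s = ε * (j * m - i * n)
    cancel : ∀ k → k * (ε * ε) ≡ k
    cancel k = trans (cong (k *_) ε²≡1) (*-identityʳ k)
    lemma₁ : ∀ i j m n p q →
      (m * q - n * p) * (i * q - j * p) * m + (m * q - n * p) * (j * m - i * n) * p
        ≡ i * ((m * q - n * p) * (m * q - n * p))
    lemma₁ = solve-∀
    lemma₂ : ∀ i j m n p q →
      (m * q - n * p) * (i * q - j * p) * n + (m * q - n * p) * (j * m - i * n) * q
        ≡ j * ((m * q - n * p) * (m * q - n * p))
    lemma₂ = solve-∀

  Δ : Carrierᴹ → Carrierᴹ → ℤ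
  Δ v w = Q v * Q w - B v w * B v w

  -- A change of coordinates P sends the Gram matrix G to P G Pᵗ, so the Gram determinant is
  -- multiplied by (det P)².
  Δ-comb : ∀ m n p q v w →
    Δ (comb m n v w) (comb p q v w) ≡ (m * q - n * p) * (m * q - n * p) * Δ v w
  Δ-comb m n p q v w = trans
    (cong₂ _-_ (cong₂ _*_ (B-comb m n m n v w) (B-comb p q p q v w))
               (cong₂ _*_ (B-comb m n p q v w) (B-comb m n p q v w)))
    (lemma m n p q (Q v) (B v w) (Q w))
    where
    lemma : ∀ m n p q a b c →
      (m * m * a + (m * n + n * m) * b + n * n * c) * (p * p * a + (p * q + q * p) * b + q * q * c)
        - (m * p * a + (m * q + n * p) * b + n * q * c)
          * (m * p * a + (m * q + n * p) * b + n * q * c)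
      ≡ (m * q - n * p) * (m * q - n * p) * (a * c - b * b)
    lemma = solve-∀

  -- Independence is encoded as a positive Gram determinant, an integer condition that `Δ-comb`
  -- carries through every reduction step.
  record IsBinaryBasis (v w : Carrierᴹ) : Set where
    field
      spans : Spans v w
      Δ>0   : 0ℤ < Δ v w

    Qv>0 : 0ℤ < Q v
    Qv>0 = ≤∧≢⇒< (Q-nonNegative v) λ 0≡Qv → <⇒≱ Δ>0 (begin
      Q v * Q w - B v w * B v w ≡⟨ cong (λ z → z * Q w - B v w * B v w) (sym 0≡Qv) ⟩
      0ℤ * Q w - B v w * B v w  ≡⟨ lemma (Q w) (B v w) ⟩
      - (B v w * B v w)         ≤⟨ neg-mono-≤ (0≤i² (B v w)) ⟩
      0ℤ                        ∎)
      where
      open ≤-Reasoning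
      lemma : ∀ c b → 0ℤ * c - b * b ≡ - (b * b)
      lemma = solve-∀

  unimodular-basis : ∀ {v w} → IsBinaryBasis v w → ∀ m n p q →
                     (m * q - n * p) * (m * q - n * p) ≡ 1ℤ →
                     IsBinaryBasis (comb m n v w) (comb p q v w)
  unimodular-basis {v} {w} basis m n p q ε²≡1 = record
    { spans = spans-unimodular spans m n p q ε²≡1
    ; Δ>0   = subst (0ℤ <_) (sym (trans (Δ-comb m n p q v w)
        (trans (cong (_* Δ v w) ε²≡1) (*-identityˡ (Δ v w))))) Δ>0
    }
    where open IsBinaryBasis basis

  ReducedBasis : Set
  ReducedBasis = ∃[ v ] ∃[ w ] IsBinaryBasis v w × IsReduced (Q v) (B v w) (Q w)

  -- Both kinds of step, swapping v and w if Q w < Q v and replacing w by w ∓ v if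
  -- Q v < ± 2 B v w, decrease this number.
  weight : Carrierᴹ → Carrierᴹ → ℤ
  weight v w = + 2 * Q v + Q w

  private
    weight-decreases : ∀ {k} {v w v′ w′} → weight v w ≤ + suc k →
                       0ℤ < weight v w - weight v′ w′ → weight v′ w′ ≤ + k
    weight-decreases {k} {v} {w} {v′} {w′} weight≤ decrease =
      0≤i-j⇒j≤i (subst (0ℤ ≤_) (lemma (weight v w) (weight v′ w′) (+ k))
        (+-mono-≤ (i≤j⇒0≤j-i weight≤) (0<i⇒0≤i-1 decrease)))
      where
      lemma : ∀ x y k → (1ℤ + k - x) + (x - y - 1ℤ) ≡ k - y
      lemma = solve-∀

  -- The bound k on the weight makes the recursion structural. It cannot reach 0, because Q v > 0
  -- and Q w ≥ 0.
  reduce : ∀ k {v w} → IsBinaryBasis v w → weight v w ≤ + k → ReducedBasis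
  reduce zero    {v} {w} basis weight≤0 = contradiction weight≤0
    (<⇒≱ (+-mono-<-≤ (0<i*j {+ 2} (+<+ (ℕ.s≤s ℕ.z≤n)) (IsBinaryBasis.Qv>0 basis)) (Q-nonNegative w)))
  reduce (suc k) {v} {w} basis weight≤
    with Q v ≤? Q w | + 2 * B v w ≤? Q v | - (+ 2 * B v w) ≤? Q v
  ... | yes a≤c | yes 2b≤a | yes -2b≤a = v , w , basis , record
    { a>0   = IsBinaryBasis.Qv>0 basis
    ; a≤c   = i≤j⇒0≤j-i a≤c
    ; 2b≤a  = i≤j⇒0≤j-i 2b≤a
    ; -a≤2b = subst (0ℤ ≤_) (cong (λ z → Q v + z) (neg-involutive (+ 2 * B v w))) (i≤j⇒0≤j-i -2b≤a)
    }
  -- The weight drops by Q v - Q w here, by 2 B v w - Q v in the next clause and by -2 B v w - Q v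
  -- in the last. Each is positive by the failed test.
  ... | no a≰c | _ | _ = reduce k (unimodular-basis basis 0ℤ 1ℤ 1ℤ 0ℤ refl)
    (weight-decreases weight≤ (subst (0ℤ <_)
      (trans (lemma (Q v) (B v w) (Q w)) (cong₂ (λ a′ c′ → weight v w - (+ 2 * a′ + c′))
        (sym (B-comb 0ℤ 1ℤ 0ℤ 1ℤ v w)) (sym (B-comb 1ℤ 0ℤ 1ℤ 0ℤ v w))))
      (i<j⇒0<j-i (≰⇒> a≰c))))
    where
    lemma : ∀ a b c → a - c ≡ (+ 2 * a + c)
      - (+ 2 * (0ℤ * 0ℤ * a + (0ℤ * 1ℤ + 1ℤ * 0ℤ) * b + 1ℤ * 1ℤ * c)
         + (1ℤ * 1ℤ * a + (1ℤ * 0ℤ + 0ℤ * 1ℤ) * b + 0ℤ * 0ℤ * c))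
    lemma = solve-∀
  ... | yes _ | no 2b≰a | _ = reduce k (unimodular-basis basis 1ℤ 0ℤ -1ℤ 1ℤ refl)
    (weight-decreases weight≤ (subst (0ℤ <_)
      (trans (lemma (Q v) (B v w) (Q w)) (cong₂ (λ a′ c′ → weight v w - (+ 2 * a′ + c′))
        (sym (B-comb 1ℤ 0ℤ 1ℤ 0ℤ v w)) (sym (B-comb -1ℤ 1ℤ -1ℤ 1ℤ v w))))
      (i<j⇒0<j-i (≰⇒> 2b≰a))))
    where
    lemma : ∀ a b c → + 2 * b - a ≡ (+ 2 * a + c)
      - (+ 2 * (1ℤ * 1ℤ * a + (1ℤ * 0ℤ + 0ℤ * 1ℤ) * b + 0ℤ * 0ℤ * c)
         + (-1ℤ * -1ℤ * a + (-1ℤ * 1ℤ + 1ℤ * -1ℤ) * b + 1ℤ * 1ℤ * c))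
    lemma = solve-∀
  ... | yes _ | yes _ | no -2b≰a = reduce k (unimodular-basis basis 1ℤ 0ℤ 1ℤ 1ℤ refl)
    (weight-decreases weight≤ (subst (0ℤ <_)
      (trans (lemma (Q v) (B v w) (Q w)) (cong₂ (λ a′ c′ → weight v w - (+ 2 * a′ + c′))
        (sym (B-comb 1ℤ 0ℤ 1ℤ 0ℤ v w)) (sym (B-comb 1ℤ 1ℤ 1ℤ 1ℤ v w))))
      (i<j⇒0<j-i (≰⇒> -2b≰a))))
    where
    lemma : ∀ a b c → - (+ 2 * b) - a ≡ (+ 2 * a + c)
      - (+ 2 * (1ℤ * 1ℤ * a + (1ℤ * 0ℤ + 0ℤ * 1ℤ) * b + 0ℤ * 0ℤ * c)
         + (1ℤ * 1ℤ * a + (1ℤ * 1ℤ + 1ℤ * 1ℤ) * b + 1ℤ * 1ℤ * c))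
    lemma = solve-∀

  reducedBasis : ∀ {v w} → IsBinaryBasis v w → ReducedBasis
  reducedBasis {v} {w} basis = reduce ∣ weight v w ∣ basis (i≤∣i∣ (weight v w))
    where
    i≤∣i∣ : ∀ i → i ≤ + ∣ i ∣
    i≤∣i∣ (+ n)    = ≤-refl
    i≤∣i∣ -[1+ n ] = -≤+

  -- Positive Gram determinant of a rank-two basis.

  rank2⇒binaryBasis : (basis : FiniteBasis module′) → FiniteBasis.rank basis ≡ 2 →
                      ∃[ v ] ∃[ w ] IsBinaryBasis v w
  -- Taking the basis apart frees its rank as a variable, so that `refl` can set it to 2.
  rank2⇒binaryBasis
    record { vec = vec ; spanning = spanning ; independent = independent } refl =
    v , w , record { spans = spans ; Δ>0 = Δ>0 }
    where
    v w : Carrierᴹ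
    v = vec zero
    w = vec (suc zero)

    linComb≈comb : ∀ c → linComb module′ c vec ≈ᴹ comb (c zero) (c (suc zero)) v w
    linComb≈comb c = +ᴹ-congˡ (+ᴹ-identityʳ _)

    spans : Spans v w
    spans x with spanning x
    ... | c , x≈ = c zero , c (suc zero) , ≈ᴹ-trans x≈ (linComb≈comb c)

    comb-independent : ∀ m n → comb m n v w ≈ᴹ 0ᴹ → m ≡ 0ℤ × n ≡ 0ℤ
    comb-independent m n comb≈0 = vanishes zero , vanishes (suc zero)
      where
      c : Fin 2 → ℤ
      c zero    = m
      c (suc _) = n
      vanishes : ∀ i → c i ≡ 0ℤ
      vanishes = independent c (≈ᴹ-trans (linComb≈comb c) comb≈0)

    Q-comb>0 : ∀ m n → ¬ (m ≡ 0ℤ × n ≡ 0ℤ) →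
               0ℤ < m * m * Q v + (m * n + n * m) * B v w + n * n * Q w
    Q-comb>0 m n ≢0 = subst (0ℤ <_) (B-comb m n m n v w)
      (B-posDef (comb m n v w) (λ comb≈0 → ≢0 (comb-independent m n comb≈0)))

    Qv>0 : 0ℤ < Q v
    Qv>0 = subst (0ℤ <_) (lemma (Q v) (B v w) (Q w)) (Q-comb>0 1ℤ 0ℤ λ ())
      where
      lemma : ∀ a b c → 1ℤ * 1ℤ * a + (1ℤ * 0ℤ + 0ℤ * 1ℤ) * b + 0ℤ * 0ℤ * c ≡ a
      lemma = solve-∀

    -- Q (a w − b v) = a Δ for a = Q v and b = B v w.
    Δ>0 : 0ℤ < Δ v w
    Δ>0 = *-cancelˡ-<-nonNeg (Q v) {{nonNegative (<⇒≤ Qv>0)}}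
      (subst₂ _<_ (sym (*-zeroʳ (Q v))) (lemma (Q v) (B v w) (Q w))
        (Q-comb>0 (- B v w) (Q v) λ (_ , Qv≡0) → <-irrefl (sym Qv≡0) Qv>0))
      where
      lemma : ∀ a b c → - b * - b * a + (- b * a + a * - b) * b + a * a * c ≡ a * (a * c - b * b)
      lemma = solve-∀

  -- Splitting along an orthogonal basis.

  coefficient≡0 : ∀ {v} → 0ℤ < Q v → ∀ k → B (k *ₗ v) v ≡ 0ℤ → k ≡ 0ℤ
  coefficient≡0 {v} Qv>0 k B≡0 with i*j≡0⇒i≡0∨j≡0 k (trans (sym (B-*ˡ k v v)) B≡0)
  ... | inj₁ k≡0  = k≡0
  ... | inj₂ Qv≡0 = contradiction Qv>0 (<-irrefl (sym Qv≡0))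

  -- The rank-one lattice ℤv. Pairing a relation k v = 0 with v gives k Q v = 0, so positivity of Q
  -- v makes the generator independent.
  span : ∀ v → 0ℤ < Q v → Sublattice ℓ
  span v Qv>0 = record
    { submodule = record
      { Member     = λ x → ∃[ k ] x ≈ᴹ k *ₗ v
      ; resp       = λ x≈y (k , x≈) → k , ≈ᴹ-trans (≈ᴹ-sym x≈y) x≈
      ; 0-closed   = 0ℤ , ≈ᴹ-sym (*ₗ-zeroˡ v)
      ; +-closed   = λ (k , x≈) (l , y≈) →
          k + l , ≈ᴹ-trans (+ᴹ-cong x≈ y≈) (≈ᴹ-sym (*ₗ-distribʳ v k l))
      ; neg-closed = λ {x} (k , x≈) → - k , neg-multiple x≈
      ; *-closed   = λ l (k , x≈) →
          l * k , ≈ᴹ-trans (*ₗ-congˡ x≈) (≈ᴹ-sym (*ₗ-assoc l k v))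
      }
    ; subBasis = record
      { rank        = 1
      ; vec         = λ _ → v , 1ℤ , ≈ᴹ-sym (*ₗ-identityˡ v)
      ; spanning    = λ (x , k , x≈) → (λ _ → k) , ≈ᴹ-trans x≈ (≈ᴹ-sym (+ᴹ-identityʳ _))
      ; independent = λ { c c≈0 zero →
          coefficient≡0 Qv>0 (c zero)
            (≈0⇒B≡0 (≈ᴹ-trans (≈ᴹ-sym (+ᴹ-identityʳ _)) c≈0) v) }
      }
    }
    where
    neg-multiple : ∀ {x k} → x ≈ᴹ k *ₗ v → -ᴹ x ≈ᴹ (- k) *ₗ v
    neg-multiple {x} {k} x≈ = ≈ᴹ-sym (inverseʳ-uniqueᴹ x _ (begin
      x +ᴹ (- k) *ₗ v      ≈⟨ +ᴹ-congʳ x≈ ⟩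
      k *ₗ v +ᴹ (- k) *ₗ v ≈⟨ *ₗ-distribʳ v k (- k) ⟨
      (k + - k) *ₗ v       ≈⟨ *ₗ-congʳ (+-inverseʳ k) ⟩
      0ℤ *ₗ v              ≈⟨ *ₗ-zeroˡ v ⟩
      0ᴹ                   ∎))
      where
      open SetoidReasoning ≈ᴹ-setoid
      open LeftModuleProperties module′ using (inverseʳ-uniqueᴹ)

  orthogonal-basis⇒decomposition :
    ∀ {v w} → Spans v w → (Qv>0 : 0ℤ < Q v) (Qw>0 : 0ℤ < Q w) → B v w ≡ 0ℤ →
    NonZero (span v Qv>0) × NonZero (span w Qw>0) × IsOrthogonalDirectSum (span v Qv>0) (span w Qw>0)
  orthogonal-basis⇒decomposition {v} {w} spans Qv>0 Qw>0 Bvw≡0 =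
    span-nonZero Qv>0 , span-nonZero Qw>0 , record
    { sums         = λ x → let (m , n , x≈) = spans x in
        m *ₗ v , n *ₗ w , (m , ≈ᴹ-refl) , (n , ≈ᴹ-refl) , x≈
    -- From x = k v = l w, pairing with v gives k Q v = l B w v = 0, hence k = 0.
    ; intersection = λ x (k , x≈kv) (l , x≈lw) → ≈ᴹ-trans x≈kv
        (≈ᴹ-trans (*ₗ-congʳ (coefficient≡0 Qv>0 k (trans (B-cong (≈ᴹ-sym x≈kv) ≈ᴹ-refl)
            (trans (B-cong x≈lw ≈ᴹ-refl) (trans (B-*ˡ l w v)
              (trans (cong (l *_) (trans (B-sym w v) Bvw≡0)) (*-zeroʳ l)))))))
          (*ₗ-zeroˡ v))
    ; orthogonal   = λ (k , x≈) (l , y≈) → trans (B-cong x≈ y≈)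
        (trans (B-*ˡ k v _) (trans (cong (k *_) (trans (B-*ʳ l v w)
          (trans (cong (l *_) Bvw≡0) (*-zeroʳ l)))) (*-zeroʳ k)))
    }
    where
    span-nonZero : ∀ {u} (Qu>0 : 0ℤ < Q u) → NonZero (span u Qu>0)
    span-nonZero {u} Qu>0 = u , (1ℤ , ≈ᴹ-sym (*ₗ-identityˡ u)) ,
      λ u≈0 → <-irrefl (sym (≈0⇒B≡0 u≈0 u)) Qu>0

  -- Gram matrices inside sums of proper sublattices.

  module Reduced {v w} (basis : IsBinaryBasis v w) (reduced : IsReduced (Q v) (B v w) (Q w))
                 (Bvw≢0 : B v w ≢ 0ℤ) where
    open IsBinaryBasis basis

    minimum : ∀ x → Q x ≡ 0ℤ ⊎ Q v ≤ Q x
    minimum x with spans x | Q x ≟ 0ℤ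
    ... | _            | yes Qx≡0 = inj₁ Qx≡0
    ... | m , n , x≈   | no Qx≢0  = inj₂ (subst (Q v ≤_) (sym Qx≡form)
      (reduced-minimum reduced m n (λ form≡0 → Qx≢0 (trans Qx≡form form≡0))))
      where
      Qx≡form : Q x ≡ form (Q v) (B v w) (Q w) m n
      Qx≡form = trans (B-cong x≈ x≈) (B-comb m n m n v w)

    -- The coordinates of x and y have a determinant d with d² Δ v w = Q v Q y - (B v w)².
    -- `reduced-unimodular` yields d² = 1, so x and y span along with v and w.
    spans-of-gram : ∀ x y → Q x ≡ Q v → B x y ≡ B v w → Q y ≤ Q w → Spans x y
    spans-of-gram x y Qx≡ Bxy≡ Qy≤ with spans x | spans y
    ... | m , n , x≈ | p , q , y≈ = spans-cong (≈ᴹ-sym x≈) (≈ᴹ-sym y≈)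
      (spans-unimodular spans m n p q
        (reduced-unimodular reduced {m * q - n * p} Bvw≢0 Δ>0 (minimum y) Qy≤ (begin
          (m * q - n * p) * (m * q - n * p) * Δ v w ≡⟨ Δ-comb m n p q v w ⟨
          Δ (comb m n v w) (comb p q v w)
            ≡⟨ cong₂ _-_ (cong₂ _*_ (B-cong x≈ x≈) (B-cong y≈ y≈))
                         (cong₂ _*_ (B-cong x≈ y≈) (B-cong x≈ y≈)) ⟨
          Δ x y
            ≡⟨ cong₂ _-_ (cong (_* Q y) Qx≡) (cong₂ _*_ Bxy≡ Bxy≡) ⟩
          Q v * Q y - B v w * B v w ∎)))
      where open ≡-Reasoning

    spans⇒improper : ∀ {x y} → Spans x y → (M : Sublattice ℓ) →
                     Sublattice.Member M x → Sublattice.Member M y → ¬ Proper M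
    spans⇒improper spans′ M x∈M y∈M proper = proper λ z → let (r , s , z≈) = spans′ z in
      M.resp (≈ᴹ-sym z≈) (M.+-closed (M.*-closed r x∈M) (M.*-closed s y∈M))
      where module M = Sublattice M

    -- Induction on the summands. Only Gram entries are kept, and for y only a bound, because
    -- dropping a component of y may lower its norm.
    no-gram-in-⨁ : (S : List (Sublattice ℓ)) → All Proper S →
                   let open ℤLattice (⨁ S) renaming (B to B′) in
                   ∀ x y → B′ x x ≡ Q v → B′ x y ≡ B v w → B′ y y ≤ Q w → ⊥
    no-gram-in-⨁ []      _            _ _ _ 0≡B _ = Bvw≢0 (sym 0≡B)
    no-gram-in-⨁ (M ∷ S) (proper ∷ propers) ((x , x∈) , x′) ((y , y∈) , y′) Qx≡ Bxy≡ Qy≤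
      with minimum x
    -- A first component of norm 0 pairs to 0 with everything, so all Gram data of x pass to the
    -- remaining summands.
    ... | inj₁ Qx≡0 = no-gram-in-⨁ S propers x′ y′
      (trans (sym (+-identityˡ _)) (trans (cong (_+ S.Q x′) (sym Qx≡0)) Qx≡))
      (trans (sym (+-identityˡ _)) (trans (cong (_+ S.B x′ y′) (sym (Q≡0⇒B≡0 Qx≡0 y))) Bxy≡))
      (≤-trans (i≤j+i (S.Q y′) (Q y) {{nonNegative (Q-nonNegative y)}}) Qy≤)
      where
      module S = Lattice (⨁ S)
    -- The first component already uses up the norm Q v, so the rest `x′` has norm 0 and adds
    -- nothing to the pairing with y.
    ... | inj₂ Qv≤Qx = spans⇒improper
      (spans-of-gram x y
        (trans (sym (+-identityʳ _)) (trans (cong (λ z → Q x + z) (sym Qx′≡0)) Qx≡))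
        (trans (sym (+-identityʳ _)) (trans (cong (λ z → B x y + z) (sym (S.Q≡0⇒B≡0 Qx′≡0 y′))) Bxy≡))
        (≤-trans (i≤i+j (Q y) (S.Q y′) {{nonNegative (S.Q-nonNegative y′)}}) Qy≤))
      M x∈ y∈ proper
      where
      module S = Lattice (⨁ S)
      Qx′≡0 : S.Q x′ ≡ 0ℤ
      Qx′≡0 = ≤-antisym
        (0≤i-j⇒j≤i (subst (0ℤ ≤_) (trans (cong (λ z → Q x - z) (sym Qx≡)) (lemma (Q x) (S.Q x′)))
          (i≤j⇒0≤j-i Qv≤Qx)))
        (S.Q-nonNegative x′)
        where
        lemma : ∀ i j → i - (i + j) ≡ 0ℤ - j
        lemma = solve-∀

proposition3p6 : (ℓ : ℤLattice) → ℤLattice.rank ℓ ≡ 2 → Indecomposable ℓ → ¬ Recoverable ℓ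
proposition3p6 ℓ rank≡2 indecomposable (S , propers , recovers)
  with Binary.rank2⇒binaryBasis ℓ (ℤLattice.basis ℓ) rank≡2
... | _ , _ , basis₀ with Binary.reducedBasis ℓ basis₀
... | v , w , basis , reduced =
  no-gram-in-⨁ S propers (σ v) (σ w) (σ-B v v) (σ-B v w) (≤-reflexive (σ-B w w))
  where
  open ℤLattice ℓ using (B)
  open Binary ℓ
  open IsBinaryBasis basis
  open IsReduced reduced
  open _Represents_ (recovers (⨁ S) (⨁-represents S))

  Bvw≢0 : B v w ≢ 0ℤ
  -- Otherwise ℓ splits as ℤv ⟂ ℤw. Both summands are nonzero, since Q w ≥ Q v > 0.
  Bvw≢0 Bvw≡0 = indecomposable (_ , _ , orthogonal-basis⇒decomposition spans a>0
    (<-≤-trans a>0 (0≤i-j⇒j≤i a≤c)) Bvw≡0)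

  open Reduced basis reduced Bvw≢0
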